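{- For every integer $n\ge 1$, $|\mathcal{S}_n(32;\,1\to 2)| = B_n$, where $B_n$ is the $n$-th Bell number.
   Context: $[n]=\{1,\dots,n\}$, and $\mathcal{S}_n$ is the set of permutations $\pi=\pi_1\pi_2\cdots\pi_n$ of $[n]$ in one-line notation. The permutation $\hat\pi$: for $\pi\in\mathcal{S}_n$, $\hat\pi\in\mathcal{S}_n$ is the permutation whose cycle form is obtained from the word $\pi_1\cdots\pi_n$ by inserting a left parenthesis before each left-to-right maximum (an entry larger than all entries to its left) and a right parenthesis immediately before the next left-to-right maximum, or at the end of the word. A cycle $(c_1,c_2,\dots,c_s)$ means $c_1\mapsto c_2\mapsto\cdots\mapsto c_s\mapsto c_1$. Example: if $\pi=2537164$ then $\hat\pi=(2)(53)(7164)$. Arrow patterns: an arrow pattern of size $k$ is a pair $(\nu;H)$ where $\nu=\nu_1\cdots\nu_m$ is a word of distinct positive integers, $H$ is a collection of arrows $b_i\to c_i$, and the set of all integers appearing in $\nu$ or $H$ is $[k]$. A permutation $\pi\in\mathcal{S}_n$ contains $(\nu;H)$ if there are a set $X=\{x_1<x_2<\cdots<x_k\}\subseteq[n]$ and indices $t_1<\cdots<t_m$ such that $\pi_{t_1}\pi_{t_2}\cdots\pi_{t_m}=x_{\nu_1}x_{\nu_2}\cdots x_{\nu_m}$ and $\hat\pi(x_{b_i})=x_{c_i}$ for every arrow $b_i\to c_i$ in $H$. Otherwise $\pi$ avoids $(\nu;H)$. $\mathcal{S}_n(\nu;H)$ is the set of permutations in $\mathcal{S}_n$ avoiding $(\nu;H)$.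 The Bell number $B_n$ is the number of set partitions of $[n]$. -}

module Defs where

open import Data.Bool.Base using (Bool; T)
open import Data.Fin.Base using (Fin; _<_)
open import Data.Fin.Patterns using (0F; 1F; 2F)
open import Data.Fin.Permutation using (Permutation′; _⟨$⟩ʳ_)
open import Data.Fin.Properties using (_≟_; _<?_)
open import Data.Fin.Subset using (Subset; Nonempty; _∈_)
open import Data.List.Base using (List; []; _∷_; foldr; tabulate; [_])
open import Data.List.Relation.Unary.All using (All; all?)
open import Data.List.Relation.Unary.Any as Any using (Any)
open import Data.Nat.Base using (ℕ)
open import Data.Product.Base using (Σ-syntax; ∃-syntax; _×_; _,_; proj₁)
open import Data.Sum.Base using (_⊎_; inj₁; inj₂)
open import Data.Vec.Base using (Vec; []; _∷_; lookup)
import Data.Vec.Membership.Propositional as Vec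
import Data.Vec.Relation.Unary.All as All
import Data.Vec.Relation.Unary.AllPairs as AllPairs
import Data.Vec.Relation.Unary.Any as VecAny
open import Data.Vec.Relation.Unary.Unique.Propositional using (Unique)
open import Function.Base using (_∘_; id)
open import Function.Bundles using (Bijection)
open import Level using (0ℓ)
open import Relation.Binary.Bundles using (Setoid)
import Relation.Binary.Construct.On as On
open import Relation.Binary.PropositionalEquality
  using (_≡_; refl; setoid; _→-setoid_)
open import Relation.Nullary.Decidable using (yes; no)
open import Relation.Nullary.Negation using (¬_)

-- Throughout, [n] = {1,…,n} is represented by Fin n = {0,…,n-1}, the
-- element i of [n] being i-1; π ⟨$⟩ʳ i is the entry of the word of π at
-- position i.

private
  variable
    n k m : ℕ

_HasCardinality_ : Setoid 0ℓ 0ℓ → ℕ → Set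
S HasCardinality c = Bijection S (setoid (Fin c))

oneLine : Permutation′ n → List (Fin n)
oneLine π = tabulate (π ⟨$⟩ʳ_)

-- splitCycles left w cuts the word w before each entry larger than all
-- entries to its left, where left lists the entries preceding w.  The
-- first component is the (possibly empty) part of w that continues the
-- cycle currently open.
splitCycles : List (Fin n) → List (Fin n) → List (Fin n) × List (List (Fin n))
splitCycles left []      = [] , []
splitCycles left (y ∷ w) with all? (_<? y) left | splitCycles (y ∷ left) w
... | yes _ | c , cs = [] , (y ∷ c) ∷ cs
... | no  _ | c , cs = y ∷ c , cs

-- With nothing to its left the first entry always opens a cycle, so the
-- first component is then empty.
cycleForm : Permutation′ n → List (List (Fin n))
cycleForm π with splitCycles [] (oneLine π)
... | _ , cs = cs

-- The cycle (c₁,…,cₛ) acts by c₁ ↦ c₂ ↦ ⋯ ↦ cₛ ↦ c₁ and fixes all other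
-- points.  next c₁ a as x is the image of x when a ∷ as is the part of the
-- cycle still to be searched for x.
next : Fin n → Fin n → List (Fin n) → Fin n → Fin n
next first a []       x with x ≟ a
... | yes _ = first
... | no  _ = x
next first a (b ∷ bs) x with x ≟ a
... | yes _ = b
... | no  _ = next first b bs x

applyCycle : List (Fin n) → Fin n → Fin n
applyCycle []      x = x
applyCycle (a ∷ c) x = next a a c x

-- π̂.  The cycles are disjoint, so the order of composition is immaterial.
hat : Permutation′ n → Fin n → Fin n
hat π = foldr (λ c f → applyCycle c ∘ f) id (cycleForm π)

record ArrowPattern (k : ℕ) : Set where
  field
    {len}    : ℕ
    ν        : Vec (Fin k) len
    H        : List (Fin k × Fin k)      -- (b , c) is the arrow b → c
    distinct : Unique ν
    covers   : ∀ j → j Vec.∈ ν ⊎ Any (λ (b , c) → j ≡ b ⊎ j ≡ c) H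

StrictlyIncreasing : (Fin m → Fin n) → Set
StrictlyIncreasing f = ∀ {i j} → i < j → f i < f j

-- The set X = {x₁ < ⋯ < xₖ} is given by its increasing enumeration x.
Contains : Permutation′ n → ArrowPattern k → Set
Contains {n} {k} π p =
  Σ[ x ∈ (Fin k → Fin n) ] Σ[ t ∈ (Fin len → Fin n) ]
    StrictlyIncreasing x ×
    StrictlyIncreasing t ×
    (∀ i → π ⟨$⟩ʳ t i ≡ x (lookup ν i)) ×
    All (λ (b , c) → hat π (x b) ≡ x c) H
  where open ArrowPattern p

Avoids : Permutation′ n → ArrowPattern k → Set
Avoids π p = ¬ Contains π p

-- 𝒮ₙ(ν;H); two permutations are equal when their words are.
Avoiders : (n : ℕ) → ArrowPattern k → Setoid 0ℓ 0ℓ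
Avoiders n p = On.setoid {B = Σ[ π ∈ Permutation′ n ] Avoids π p}
  (Fin n →-setoid Fin n) (λ (π , _) → π ⟨$⟩ʳ_)

-- (32; 1→2), with the labels 1, 2, 3 shifted to 0, 1, 2.
pattern-32-1→2 : ArrowPattern 3
pattern-32-1→2 = record
  { ν        = 2F ∷ 1F ∷ []
  ; H        = [ 0F , 1F ]
  ; distinct = ((λ ()) All.∷ All.[]) AllPairs.∷ (All.[] AllPairs.∷ AllPairs.[])
  ; covers   = λ where
      0F → inj₂ (Any.here (inj₁ refl))
      1F → inj₁ (VecAny.there (VecAny.here refl))
      2F → inj₁ (VecAny.here refl)
  }

-- A set of subsets is given by its characteristic function.
record IsSetPartition (F : Subset n → Bool) : Set where
  field
    nonempty : ∀ {A} → T (F A) → Nonempty A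
    disjoint : ∀ {A B i} → T (F A) → T (F B) → i ∈ A → i ∈ B → A ≡ B
    covering : ∀ i → ∃[ A ] (T (F A) × i ∈ A)

SetPartitions : ℕ → Setoid 0ℓ 0ℓ
SetPartitions n = On.setoid {B = Σ[ F ∈ (Subset n → Bool) ] IsSetPartition F}
  (Subset n →-setoid Bool) proj₁

IsBellNumber : ℕ → ℕ → Set
IsBellNumber n b = SetPartitions n HasCardinality b

{-# OPTIONS --safe #-}
module Submission where

-- By the arrow 1→2, a permutation π avoids (32; 1→2) exactly when every entry
-- that is larger than the entry just before it is a left-to-right maximum.
-- Indeed π̂ maps an entry to the next one, except that the last entry of a
-- cycle goes back to a left-to-right maximum, and a left-to-right maximum
-- cannot play the role of 2.  So the cycles of π̂ are decreasing in the word
-- of π, their maxima increase, and π amounts to the set partition into these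
-- cycles.  Both set partitions and avoiders are matched with the functions
-- f : [n] → [n] satisfying i ≤ f i and f (f i) = f i: for a partition, f i is
-- the maximum of the block of i; for an avoider, it is the largest entry up to
-- and including i.

open import Defs
open import Data.Bool.Base using (Bool; T; true)
open import Data.Bool.Properties as Bool using (T-≡; ⇔→≡)
open import Data.Fin.Base using
  (Fin; zero; suc; _<_; _≤_; toℕ; fromℕ<; inject₁; punchOut; finToFun; funToFin)
open import Data.Fin.Patterns using (0F; 1F; 2F)
open import Data.Fin.Permutation using
  (Permutation′; _⟨$⟩ʳ_; _⟨$⟩ˡ_; inverseˡ; inverseʳ; permutation)
open import Data.Fin.Properties as Fin
  using (_≟_; _≤?_; _<?_; any?; finToFun-funToFin; funToFin-finToFin; toℕ-inject₁)
open import Data.Fin.Induction using (<-weakInduction)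
open import Data.Fin.Subset using (Subset; _∈_; _⊂_; ⊤; ∣_∣)
open import Data.Fin.Subset.Properties using (_∈?_; ⊆-antisym; p⊂q⇒∣p∣<∣q∣; ∣⊤∣≡n; ∈⊤)
open import Data.List.Base using (List; []; _∷_; foldr; tabulate)
open import Data.List.Relation.Unary.All as All using (All; []; _∷_)
import Data.List.Relation.Unary.All.Properties as All
open import Data.Nat.Base as ℕ using (ℕ; z≤n; s≤s; s≤s⁻¹; z<s; s<s)
import Data.Nat.Properties as ℕ
open import Data.Product.Base using (Σ-syntax; ∃; ∃-syntax; _×_; _,_; proj₁; proj₂)
open import Data.Sum.Base as Sum using (_⊎_; inj₁; inj₂)
import Data.Vec.Base as Vec
open import Data.Vec.Properties using (lookup∘tabulate; []=⇒lookup; lookup⇒[]=)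
import Data.Vec.Properties as Vec
open import Function.Base using (_∘_; id)
open import Function.Bundles using (Bijection; Equivalence; mk⇔)
open import Function.Consequences.Setoid using (strictlySurjective⇒surjective)
import Function.Construct.Composition as Composition
open import Function.Definitions using (Injective; StrictlySurjective; Congruent)
open import Level using (0ℓ)
open import Relation.Binary.Bundles using (Setoid)
import Relation.Binary.Construct.On as On
open import Relation.Binary.Core using (Rel)
open import Relation.Binary.Definitions
  using (Reflexive; Transitive; Symmetric; Trichotomous; Tri; tri<; tri≈; tri>)
  renaming (Decidable to Decidable₂)
open import Relation.Binary.PropositionalEquality
  using (_≡_; _≢_; _≗_; refl; sym; trans; cong; subst; subst₂; isEquivalence; setoid; _→-setoid_)
open import Relation.Binary.Structures using (IsStrictTotalOrder)
open import Relation.Binary.Structures.Biased using (isStrictTotalOrderᶜ)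
open import Relation.Nullary.Decidable
  using (Dec; yes; no; _×-dec_; map′; ⌊_⌋; toWitness; fromWitness)
open import Relation.Nullary.Negation using (¬_; contradiction)
open import Relation.Unary using (Pred; Decidable)

open Setoid using (Carrier; _≈_)

private
  variable
    m n : ℕ

mkBijection : (S T : Setoid 0ℓ 0ℓ) (to : Carrier S → Carrier T) →
  Congruent (_≈_ S) (_≈_ T) to → Injective (_≈_ S) (_≈_ T) to →
  StrictlySurjective (_≈_ T) to → Bijection S T
mkBijection S T to to-cong injective surjective = record
  { to        = to
  ; cong      = to-cong
  ; bijective = injective , strictlySurjective⇒surjective S T to-cong surjective
  }

-- Finite cardinalities

-- Elements of `∃ Q` are compared by first components alone, since a witness may have several
-- proofs. The induction asks whether `zero` belongs to the subset and, if so, gives it a new index.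
Fin-subset-finite : ∀ {N} {Q : Pred (Fin N) 0ℓ} → Decidable Q →
  ∃[ c ] (On.setoid {B = ∃ Q} (setoid (Fin N)) proj₁ HasCardinality c)
Fin-subset-finite {ℕ.zero} {Q} Q? =
  0 , mkBijection (On.setoid (setoid _) proj₁) (setoid _)
    (λ where (() , _)) (λ { {() , _} }) (λ { {() , _} }) (λ ())
Fin-subset-finite {ℕ.suc N} {Q} Q? with Q? zero | Fin-subset-finite (Q? ∘ suc)
... | yes q₀ | c , bij = ℕ.suc c ,
  mkBijection (On.setoid (setoid _) proj₁) (setoid _) to to-cong to-injective to-surjective
  where
  module B = Bijection bij
  to : ∃ Q → Fin (ℕ.suc c)
  to (zero  , _) = zero
  to (suc i , q) = suc (B.to (i , q))
  to-cong : ∀ {x y} → proj₁ x ≡ proj₁ y → to x ≡ to y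
  to-cong {zero  , _} {_ , _} refl = refl
  to-cong {suc i , _} {_ , _} refl = cong suc (B.cong refl)
  to-injective : ∀ {x y} → to x ≡ to y → proj₁ x ≡ proj₁ y
  to-injective {zero  , _} {zero  , _} _  = refl
  to-injective {suc i , _} {suc j , _} eq = cong suc (B.injective (Fin.suc-injective eq))
  to-surjective : StrictlySurjective _≡_ to
  to-surjective zero    = (zero , q₀) , refl
  to-surjective (suc j) with B.strictlySurjective j
  ... | (i , q) , eq = (suc i , q) , cong suc eq
... | no ¬q₀ | c , bij = c ,
  mkBijection (On.setoid (setoid _) proj₁) (setoid _) to to-cong to-injective to-surjective
  where
  module B = Bijection bij
  to : ∃ Q → Fin c
  to (zero  , q) = contradiction q ¬q₀
  to (suc i , q) = B.to (i , q)
  to-cong : ∀ {x y} → proj₁ x ≡ proj₁ y → to x ≡ to y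
  to-cong {zero  , q} {_ , _} _    = contradiction q ¬q₀
  to-cong {suc i , _} {_ , _} refl = B.cong refl
  to-injective : ∀ {x y} → to x ≡ to y → proj₁ x ≡ proj₁ y
  to-injective {zero  , q} {_}         _  = contradiction q ¬q₀
  to-injective {suc _ , _} {zero  , q} _  = contradiction q ¬q₀
  to-injective {suc i , _} {suc j , _} eq = cong suc (B.injective eq)
  to-surjective : StrictlySurjective _≡_ to
  to-surjective j with B.strictlySurjective j
  ... | (i , q) , eq = (suc i , q) , eq

funToFin-cong : {f g : Fin m → Fin n} → f ≗ g → funToFin f ≡ funToFin g
funToFin-cong {ℕ.zero}  f≗g = refl
funToFin-cong {ℕ.suc m} f≗g rewrite f≗g zero | funToFin-cong (f≗g ∘ suc) = refl

-- Functions are coded as elements of `Fin (n ^ m)`. Decoding returns the function only up to `≗`,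
-- which is why `Q` has to respect `≗`.
function-subset-finite : {Q : Pred (Fin m → Fin n) 0ℓ} → Decidable Q →
  (∀ {f g} → f ≗ g → Q f → Q g) →
  ∃[ c ] (On.setoid {B = ∃ Q} (Fin m →-setoid Fin n) proj₁ HasCardinality c)
function-subset-finite {m} {n} {Q} Q? Q-resp
  with Fin-subset-finite {Q = Q ∘ finToFun} (Q? ∘ finToFun)
... | c , bij = c , Composition.bijection
  (mkBijection (On.setoid (Fin m →-setoid Fin n) proj₁) (On.setoid (setoid (Fin (n ℕ.^ m))) proj₁)
    (λ (f , q) → funToFin f , Q-resp (λ i → sym (finToFun-funToFin f i)) q)
    funToFin-cong
    (λ {x} {y} eq i → trans (sym (finToFun-funToFin (proj₁ x) i))
      (trans (cong (λ k → finToFun k i) eq) (finToFun-funToFin (proj₁ y) i)))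
    (λ (k , q) → (finToFun k , q) , funToFin-finToFin {m} k))
  bij

-- Closure functions

Greatest : Pred (Fin n) 0ℓ → Pred (Fin n) 0ℓ
Greatest P m = P m × (∀ k → P k → k ≤ m)

greatest : {P : Pred (Fin n) 0ℓ} → Decidable P → ∃ P → ∃ (Greatest P)
greatest {ℕ.suc n} {P} P? (i , Pi) with any? (P? ∘ suc)
... | yes ∃P = let m , Pm , max = greatest (P? ∘ suc) ∃P in
  suc m , Pm , λ where
    zero    _  → z≤n
    (suc k) Pk → s≤s (max k Pk)
... | no ∄P = zero , P₀ i Pi , λ where
    zero    _  → z≤n
    (suc k) Pk → contradiction (k , Pk) ∄P
  where
  P₀ : ∀ i → P i → P zero
  P₀ zero    P0 = P0
  P₀ (suc k) Pk = contradiction (k , Pk) ∄P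

-- Such a map is a partition in disguise: the blocks are its fibres, and the value on a fibre is the
-- greatest element of that fibre. Monotonicity is not demanded, so this is weaker than a closure
-- operator.
record IsClosure (f : Fin n → Fin n) : Set where
  field
    inflationary : ∀ i → i ≤ f i
    idempotent   : ∀ i → f (f i) ≡ f i

isClosure? : Decidable (IsClosure {n})
isClosure? f = map′
  (λ (p , q) → record { inflationary = p ; idempotent = q })
  (λ c → IsClosure.inflationary c , IsClosure.idempotent c)
  (Fin.all? (λ i → i ≤? f i) ×-dec Fin.all? (λ i → f (f i) ≟ f i))

isClosure-resp : {f g : Fin n → Fin n} → f ≗ g → IsClosure f → IsClosure g
isClosure-resp {f = f} {g} f≗g c = record
  { inflationary = λ i → subst (i ≤_) (f≗g i) (inflationary i)
  ; idempotent   = λ i → trans (sym (f≗g (g i)))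
      (trans (cong f (sym (f≗g i))) (trans (idempotent i) (f≗g i)))
  }
  where open IsClosure c

Closures : ℕ → Setoid 0ℓ 0ℓ
Closures n = On.setoid {B = Σ[ f ∈ (Fin n → Fin n) ] IsClosure f} (Fin n →-setoid Fin n) proj₁

closures-finite : ∀ n → ∃[ c ] (Closures n HasCardinality c)
closures-finite n = function-subset-finite isClosure? isClosure-resp

-- One construction serves both sides: `R` is the relation of lying in one block for a partition,
-- and that of standing no later in the word for a permutation.
module GreatestBelow (R : Rel (Fin n) 0ℓ) (R? : Decidable₂ R)
  (R-refl : Reflexive R) (R-trans : Transitive R) where

  closure : Fin n → Fin n
  closure v = proj₁ (greatest (λ u → R? u v) (v , R-refl))

  closure-below : ∀ v → R (closure v) v
  closure-below v = proj₁ (proj₂ (greatest (λ u → R? u v) (v , R-refl)))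

  closure-greatest : ∀ {u v} → R u v → u ≤ closure v
  closure-greatest {u} {v} = proj₂ (proj₂ (greatest (λ u → R? u v) (v , R-refl))) u

  closure-mono : ∀ {u v} → R u v → closure u ≤ closure v
  closure-mono Ruv = closure-greatest (R-trans (closure-below _) Ruv)

  closure-unique : ∀ {m v} → Greatest (λ u → R u v) m → closure v ≡ m
  closure-unique (Rmv , max) =
    Fin.≤-antisym (max _ (closure-below _)) (closure-greatest Rmv)

  isClosure : IsClosure closure
  isClosure = record
    { inflationary = λ i → closure-greatest R-refl
    ; idempotent   = λ i → Fin.≤-antisym
        (closure-mono (closure-below i)) (closure-greatest R-refl)
    }

  closure-≡⇒R : Symmetric R → ∀ {u v} → closure u ≡ closure v → R u v
  closure-≡⇒R R-sym {u} {v} eq =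
    R-trans (R-sym (closure-below u)) (subst (λ w → R w v) (sym eq) (closure-below v))

  R⇒closure-≡ : Symmetric R → ∀ {u v} → R u v → closure u ≡ closure v
  R⇒closure-≡ R-sym Ruv = Fin.≤-antisym (closure-mono Ruv) (closure-mono (R-sym Ruv))

-- Subsets given by decidable predicates

⟦_⟧ : {P : Pred (Fin n) 0ℓ} → Decidable P → Subset n
⟦ P? ⟧ = Vec.tabulate (λ i → ⌊ P? i ⌋)

∈⟦⟧⁺ : {P : Pred (Fin n) 0ℓ} (P? : Decidable P) → ∀ {i} → P i → i ∈ ⟦ P? ⟧
∈⟦⟧⁺ P? {i} Pi = lookup⇒[]= i _ (trans (lookup∘tabulate _ i) (Equivalence.to T-≡ (fromWitness Pi)))

∈⟦⟧⁻ : {P : Pred (Fin n) 0ℓ} (P? : Decidable P) → ∀ {i} → i ∈ ⟦ P? ⟧ → P i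
∈⟦⟧⁻ P? {i} i∈ =
  toWitness (Equivalence.from T-≡ (trans (sym (lookup∘tabulate _ i)) ([]=⇒lookup i∈)))

-- Set partitions

module Partition {F : Subset n → Bool} (isP : IsSetPartition F) where
  open IsSetPartition isP

  SameBlock : Rel (Fin n) 0ℓ
  SameBlock u v = ∃[ A ] (T (F A) × u ∈ A × v ∈ A)

  sameBlock? : Decidable₂ SameBlock
  -- `covering` yields a block of `u`, and disjointness makes it the only candidate, so a single
  -- membership test decides.
  sameBlock? u v = let A , A∈F , u∈A = covering u in map′
    (λ v∈A → A , A∈F , u∈A , v∈A)
    (λ (B , B∈F , u∈B , v∈B) → subst (v ∈_) (disjoint B∈F A∈F u∈B u∈A) v∈B)
    (v ∈? A)

  sameBlock-refl : Reflexive SameBlock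
  sameBlock-refl {u} = let A , A∈F , u∈A = covering u in A , A∈F , u∈A , u∈A

  sameBlock-sym : Symmetric SameBlock
  sameBlock-sym (A , A∈F , u∈A , v∈A) = A , A∈F , v∈A , u∈A

  sameBlock-trans : Transitive SameBlock
  sameBlock-trans (A , A∈F , u∈A , v∈A) (B , B∈F , v∈B , w∈B) =
    A , A∈F , u∈A , subst (_ ∈_) (disjoint B∈F A∈F v∈B v∈A) w∈B

  open GreatestBelow SameBlock sameBlock? sameBlock-refl sameBlock-trans public

module _ {F G : Subset n → Bool} (isF : IsSetPartition F) (isG : IsSetPartition G) where
  private
    module F = Partition isF
    module G = Partition isG

  blockMax-cong : F ≗ G → F.closure ≗ G.closure
  blockMax-cong F≗G v = F.closure-unique
    ( (let A , A∈G , p = G.closure-below v in A , subst T (sym (F≗G A)) A∈G , p)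
    , λ k (A , A∈F , p) → G.closure-greatest (A , subst T (F≗G A) A∈F , p))

  -- Equal block maxima mean the same relation of lying in one block. Hence `A` coincides with the
  -- block of `G` around any of its elements, and `nonempty` supplies one.
  blockMax-⊆ : F.closure ≗ G.closure → ∀ A → T (F A) → T (G A)
  blockMax-⊆ eq A A∈F =
    let i , i∈A       = IsSetPartition.nonempty isF A∈F
        B , B∈G , i∈B = IsSetPartition.covering isG i
        A⊆B = λ {j} j∈A →
          let C , C∈G , j∈C , i∈C = G.closure-≡⇒R G.sameBlock-sym
                (trans (sym (eq j)) (trans
                  (F.R⇒closure-≡ F.sameBlock-sym (A , A∈F , j∈A , i∈A)) (eq i)))
          in subst (j ∈_) (IsSetPartition.disjoint isG C∈G B∈G i∈C i∈B) j∈C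
        B⊆A = λ {j} j∈B →
          let C , C∈F , j∈C , i∈C = F.closure-≡⇒R F.sameBlock-sym
                (trans (eq j) (trans
                  (G.R⇒closure-≡ G.sameBlock-sym (B , B∈G , j∈B , i∈B)) (sym (eq i))))
          in subst (j ∈_) (IsSetPartition.disjoint isF C∈F A∈F i∈C i∈A) j∈C
    in subst (T ∘ G) (sym (⊆-antisym A⊆B B⊆A)) B∈G

module Fibres {f : Fin n → Fin n} (isC : IsClosure f) where
  open IsClosure isC

  fibre : Fin n → Subset n
  fibre i = ⟦ (λ j → f j ≟ f i) ⟧

  isFibre? : ∀ A → Dec (∃[ i ] (A ≡ fibre i))
  isFibre? A = any? (λ i → Vec.≡-dec Bool._≟_ A (fibre i))

  fibres : Subset n → Bool
  fibres A = ⌊ isFibre? A ⌋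

  ∈fibre⁺ : ∀ {i j} → f j ≡ f i → j ∈ fibre i
  ∈fibre⁺ {i} = ∈⟦⟧⁺ (λ j → f j ≟ f i)

  ∈fibre⁻ : ∀ {i j} → j ∈ fibre i → f j ≡ f i
  ∈fibre⁻ {i} = ∈⟦⟧⁻ (λ j → f j ≟ f i)

  fibre∈fibres : ∀ i → T (fibres (fibre i))
  fibre∈fibres i = fromWitness (i , refl)

  isSetPartition : IsSetPartition fibres
  isSetPartition = record
    { nonempty = λ A∈F → let i , A≡ = toWitness A∈F in
        i , subst (i ∈_) (sym A≡) (∈fibre⁺ refl)
    ; disjoint = λ A∈F B∈F → disj (toWitness A∈F) (toWitness B∈F)
    ; covering = λ i → fibre i , fibre∈fibres i , ∈fibre⁺ refl
    }
    where
    disj : ∀ {A B k} → ∃[ i ] (A ≡ fibre i) → ∃[ j ] (B ≡ fibre j) → k ∈ A → k ∈ B → A ≡ B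
    -- A fibre depends on its index only through the value of `f`, and the common element `k`
    -- equates the two values.
    disj (i , refl) (j , refl) k∈A k∈B = cong (λ v → ⟦ (λ j → f j ≟ v) ⟧)
      (trans (sym (∈fibre⁻ k∈A)) (∈fibre⁻ k∈B))

  -- Idempotence puts `f v` into the fibre of `v`; every `k` in that fibre is at most `f k`, which
  -- equals `f v`.
  blockMax-fibres : Partition.closure isSetPartition ≗ f
  blockMax-fibres v = Partition.closure-unique isSetPartition
    ( (fibre v , fibre∈fibres v , ∈fibre⁺ (idempotent v) , ∈fibre⁺ refl)
    , λ k (A , A∈F , k∈A , v∈A) → max k (toWitness A∈F) k∈A v∈A)
    where
    max : ∀ {A} k → ∃[ i ] (A ≡ fibre i) → k ∈ A → v ∈ A → k ≤ f v
    max k (i , refl) k∈A v∈A =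
      subst (k ≤_) (trans (∈fibre⁻ k∈A) (sym (∈fibre⁻ v∈A))) (inflationary k)

partitions⤖closures : ∀ n → Bijection (SetPartitions n) (Closures n)
partitions⤖closures n = mkBijection (SetPartitions n) (Closures n)
  (λ (F , isP) → Partition.closure isP , Partition.isClosure isP)
  (λ {x} {y} → blockMax-cong (proj₂ x) (proj₂ y))
  (λ {x} {y} eq A → ⇔→≡ {z = true} (mk⇔
    (Equivalence.to T-≡ ∘ blockMax-⊆ (proj₂ x) (proj₂ y) eq A ∘ Equivalence.from T-≡)
    (Equivalence.to T-≡ ∘ blockMax-⊆ (proj₂ y) (proj₂ x) (sym ∘ eq) A ∘ Equivalence.from T-≡)))
  (λ (f , isC) → (Fibres.fibres isC , Fibres.isSetPartition isC) , Fibres.blockMax-fibres isC)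

-- The cycle form

-- The graph of splitCycles.
data Split {n} : List (Fin n) → List (Fin n) → List (Fin n) → List (List (Fin n)) → Set where
  end  : ∀ {left} → Split left [] [] []
  cut  : ∀ {left y w c cs} → All (_< y) left →
         Split (y ∷ left) w c cs → Split left (y ∷ w) [] ((y ∷ c) ∷ cs)
  join : ∀ {left y w c cs} → ¬ All (_< y) left →
         Split (y ∷ left) w c cs → Split left (y ∷ w) (y ∷ c) cs

splitCycles-Split : (left w : List (Fin n)) →
  Split left w (proj₁ (splitCycles left w)) (proj₂ (splitCycles left w))
splitCycles-Split left []      = end
splitCycles-Split left (y ∷ w)
  with All.all? (_<? y) left | splitCycles (y ∷ left) w | splitCycles-Split (y ∷ left) w
... | yes y-max | _ | split = cut y-max split
... | no  y-not | _ | split = join y-not split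

Split-All : ∀ {P : Pred (Fin n) 0ℓ} {left w c cs} →
  Split left w c cs → All P w → All P c × All (All P) cs
Split-All end          []       = [] , []
Split-All (cut  _ s) (py ∷ pw) = let pc , pcs = Split-All s pw in [] , (py ∷ pc) ∷ pcs
Split-All (join _ s) (py ∷ pw) = let pc , pcs = Split-All s pw in py ∷ pc , pcs

-- This is the fold inside `hat`. Later cycles act first: they must fix an entry of an earlier cycle
-- (`composeCycles-fix`) and must send no other entry to it (`composeCycles-≢`).
composeCycles : List (List (Fin n)) → Fin n → Fin n
composeCycles = foldr (λ c f → applyCycle c ∘ f) id

next-head : ∀ (first a b : Fin n) bs {x} → x ≡ a → next first a (b ∷ bs) x ≡ b
next-head first a b bs {x} x≡a with x ≟ a
... | yes _   = refl
... | no  x≢a = contradiction x≡a x≢a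

next-last : ∀ (first a : Fin n) {x} → x ≡ a → next first a [] x ≡ first
next-last first a {x} x≡a with x ≟ a
... | yes _   = refl
... | no  x≢a = contradiction x≡a x≢a

next-[] : ∀ (first a : Fin n) {x} → x ≢ a → next first a [] x ≡ x
next-[] first a {x} x≢a with x ≟ a
... | yes x≡a = contradiction x≡a x≢a
... | no  _   = refl

next-∷ : ∀ (first a b : Fin n) bs {x} → x ≢ a → next first a (b ∷ bs) x ≡ next first b bs x
next-∷ first a b bs {x} x≢a with x ≟ a
... | yes x≡a = contradiction x≡a x≢a
... | no  _   = refl

next-fix : ∀ (first a : Fin n) {as x} → x ≢ a → All (x ≢_) as → next first a as x ≡ x
next-fix first a x≢a []                       = next-[] first a x≢a
next-fix first a {b ∷ bs} x≢a (x≢b ∷ x≢bs) =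
  trans (next-∷ first a b bs x≢a) (next-fix first b x≢b x≢bs)

-- Every value of `next` is `first`, an entry of `as`, or the argument itself.
next-≢ : ∀ (first a : Fin n) {as x y} →
  y ≢ first → All (y ≢_) as → x ≢ y → next first a as x ≢ y
next-≢ first a {[]}     {x} y≢first _ x≢y with x ≟ a
... | yes _ = y≢first ∘ sym
... | no  _ = x≢y
next-≢ first a {b ∷ bs} {x} y≢first (y≢b ∷ y≢bs) x≢y with x ≟ a
... | yes _ = y≢b ∘ sym
... | no  _ = next-≢ first b y≢first y≢bs x≢y

composeCycles-fix : ∀ {cs} {x : Fin n} → All (All (x ≢_)) cs → composeCycles cs x ≡ x
composeCycles-fix [] = refl
composeCycles-fix {cs = [] ∷ cs} ([] ∷ x∉cs) = composeCycles-fix x∉cs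
composeCycles-fix {cs = (a ∷ c) ∷ cs} ((x≢a ∷ x∉c) ∷ x∉cs) =
  trans (cong (next a a c) (composeCycles-fix x∉cs)) (next-fix a a x≢a x∉c)

composeCycles-≢ : ∀ {cs} {x y : Fin n} →
  All (All (y ≢_)) cs → x ≢ y → composeCycles cs x ≢ y
composeCycles-≢ [] x≢y = x≢y
composeCycles-≢ {cs = [] ∷ cs} (_ ∷ y∉cs) x≢y = composeCycles-≢ y∉cs x≢y
composeCycles-≢ {cs = (a ∷ c) ∷ cs} ((y≢a ∷ y∉c) ∷ y∉cs) x≢y =
  next-≢ a a y≢a y∉c (composeCycles-≢ y∉cs x≢y)

-- The whole word consists of the entries in `left`, in any order, followed by the word `g` in which
-- position `j` is tested.
IsLRMax : List (Fin n) → (Fin m → Fin n) → Fin m → Set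
IsLRMax left g j = All (_< g j) left × (∀ i → i < j → g i < g j)

IsLRMax-zero : ∀ {left} {g : Fin (ℕ.suc m) → Fin n} → All (_< g zero) left → IsLRMax left g zero
IsLRMax-zero max = max , λ _ ()

IsLRMax-suc⁺ : ∀ {left} {g : Fin (ℕ.suc m) → Fin n} {j} →
  IsLRMax (g zero ∷ left) (g ∘ suc) j → IsLRMax left g (suc j)
IsLRMax-suc⁺ (g₀<gⱼ ∷ max , max′) = max , λ where
  zero    _   → g₀<gⱼ
  (suc i) i<j → max′ i (s≤s⁻¹ i<j)

private
  head∉cycles : ∀ {m left c cs} {g : Fin (ℕ.suc m) → Fin n} → Injective _≡_ _≡_ g →
    Split left (tabulate (g ∘ suc)) c cs → All (All (g zero ≢_)) cs
  head∉cycles g-inj split = proj₂ (Split-All split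
    (All.tabulate⁺ λ i eq → contradiction (g-inj eq) λ ()))

  tail-inj : ∀ {m} {g : Fin (ℕ.suc m) → Fin n} → Injective _≡_ _≡_ g → Injective _≡_ _≡_ (g ∘ suc)
  tail-inj g-inj = Fin.suc-injective ∘ g-inj

  suc≢zero : ∀ {m} {g : Fin (ℕ.suc m) → Fin n} → Injective _≡_ _≡_ g → ∀ i → g (suc i) ≢ g zero
  suc≢zero g-inj i eq = contradiction (g-inj eq) λ ()

-- The suffix g of a word is read with g zero inside the open cycle, whose
-- first entry is first; c and cs come from splitting what follows g zero, so
-- that π̂ acts on the suffix as next first (g zero) c ∘ composeCycles cs.
image-of-non-LRMax : ∀ {m first left c cs} (g : Fin (ℕ.suc m) → Fin n) → Injective _≡_ _≡_ g →
  Split (g zero ∷ left) (tabulate (g ∘ suc)) c cs → ∀ i → ¬ IsLRMax left g (suc i) →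
  next first (g zero) c (composeCycles cs (g (inject₁ i))) ≡ g (suc i)
-- A cut after `g zero` makes the next entry a left-to-right maximum, which the hypothesis excludes.
image-of-non-LRMax g g-inj (cut max s) zero ¬max =
  contradiction (IsLRMax-suc⁺ (IsLRMax-zero max)) ¬max
image-of-non-LRMax {first = first} {cs = cs} g g-inj split@(join {c = c} _ s) zero ¬max =
  next-head first (g zero) (g (suc zero)) c
    (composeCycles-fix (head∉cycles g-inj split))
-- The pair lies beyond the cut, where `g (suc zero)` starts a new cycle; what remains of the closed
-- cycle leaves the result alone.
image-of-non-LRMax {first = first} g g-inj (cut max s) (suc i) ¬max =
  trans (cong (next first (g zero) []) ih)
    (next-[] first (g zero) (suc≢zero g-inj (suc i)))
  where ih = image-of-non-LRMax (g ∘ suc) (tail-inj g-inj) s i (¬max ∘ IsLRMax-suc⁺)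
-- The search of the open cycle steps past `g zero`, since the later cycles send no other entry to
-- it.
image-of-non-LRMax {first = first} g g-inj split@(join {c = c} _ s) (suc i) ¬max =
  trans (next-∷ first (g zero) _ c
      (composeCycles-≢ (head∉cycles g-inj split) (suc≢zero g-inj (inject₁ i))))
    (image-of-non-LRMax (g ∘ suc) (tail-inj g-inj) s i (¬max ∘ IsLRMax-suc⁺))

-- `toFirst` is separate because the start of the open cycle may lie to the left of `g`; once the
-- recursion returns to the cut that opened the cycle, it becomes a `toLRMax`.
data Image {n m} (first : Fin n) (left : List (Fin n)) (g : Fin (ℕ.suc m) → Fin n) :
           Fin (ℕ.suc m) → Fin n → Set where
  toFirst : ∀ {j} → Image first left g j first
  toLRMax : ∀ {j} i → IsLRMax left g i → Image first left g j (g i)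
  toNext  : ∀ i → Image first left g (inject₁ i) (g (suc i))

-- Inside a cycle an entry goes to the next entry of the word; the last entry of a cycle goes back
-- to its start, which is a left-to-right maximum.
image : ∀ {m} first {left c cs} (g : Fin (ℕ.suc m) → Fin n) → Injective _≡_ _≡_ g →
  Split (g zero ∷ left) (tabulate (g ∘ suc)) c cs → ∀ j →
  Image first left g j (next first (g zero) c (composeCycles cs (g j)))
image {m = ℕ.zero} f g g-inj end zero =
  subst (Image f _ g zero) (sym (next-last f (g zero) refl)) toFirst
image {m = ℕ.suc m} f g g-inj split@(cut _ _) zero = subst (Image f _ g zero)
  (sym (next-last f (g zero) (composeCycles-fix (head∉cycles g-inj split)))) toFirst
image {m = ℕ.suc m} f g g-inj split@(join {c = c} _ s) zero = subst (Image f _ g zero)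
  (sym (next-head f (g zero) (g (suc zero)) c (composeCycles-fix (head∉cycles g-inj split))))
  (toNext zero)
image {m = ℕ.suc m} f {left} g g-inj split@(cut max s) (suc j) = subst (Image f left g (suc j))
  (sym (next-[] f (g zero) (composeCycles-≢ (head∉cycles g-inj split) (suc≢zero g-inj j))))
  (lift (image (g (suc zero)) (g ∘ suc) (tail-inj g-inj) s j))
  where
  lift : ∀ {j y} → Image (g (suc zero)) (g zero ∷ left) (g ∘ suc) j y → Image f left g (suc j) y
  lift toFirst         = toLRMax (suc zero) (IsLRMax-suc⁺ (IsLRMax-zero max))
  lift (toLRMax i max) = toLRMax (suc i) (IsLRMax-suc⁺ max)
  lift (toNext i)      = toNext (suc i)
image {m = ℕ.suc m} f {left} g g-inj split@(join {c = c} _ s) (suc j) = subst (Image f left g (suc j))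
  (sym (next-∷ f (g zero) _ c (composeCycles-≢ (head∉cycles g-inj split) (suc≢zero g-inj j))))
  (lift (image f (g ∘ suc) (tail-inj g-inj) s j))
  where
  lift : ∀ {j y} → Image f (g zero ∷ left) (g ∘ suc) j y → Image f left g (suc j) y
  lift toFirst         = toFirst
  lift (toLRMax i max) = toLRMax (suc i) (IsLRMax-suc⁺ max)
  lift (toNext i)      = toNext (suc i)

-- Permutations

⟨$⟩ʳ-injective : (π : Permutation′ n) → Injective _≡_ _≡_ (π ⟨$⟩ʳ_)
⟨$⟩ʳ-injective π eq = trans (sym (inverseˡ π)) (trans (cong (π ⟨$⟩ˡ_) eq) (inverseˡ π))

⟨$⟩ˡ-injective : (π : Permutation′ n) → Injective _≡_ _≡_ (π ⟨$⟩ˡ_)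
⟨$⟩ˡ-injective π eq = trans (sym (inverseʳ π)) (trans (cong (π ⟨$⟩ʳ_) eq) (inverseʳ π))

inject₁<suc : (i : Fin n) → inject₁ i < suc i
inject₁<suc i = s≤s (ℕ.≤-reflexive (toℕ-inject₁ i))

<suc⇒≤inject₁ : ∀ {i : Fin (ℕ.suc n)} {j : Fin n} → i < suc j → i ≤ inject₁ j
<suc⇒≤inject₁ {i = i} {j} i<1+j = subst (toℕ i ℕ.≤_) (sym (toℕ-inject₁ j)) (s≤s⁻¹ i<1+j)

-- The larger entry at `k` prevents position `suc i` from opening a cycle. The test on the empty
-- prefix computes, so `hat π` has the form treated by `image-of-non-LRMax`, with the first entry as
-- `first`.
hat-of-non-LRMax : (π : Permutation′ (ℕ.suc m)) → ∀ {i k} → k < suc i →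
  π ⟨$⟩ʳ suc i < π ⟨$⟩ʳ k → hat π (π ⟨$⟩ʳ inject₁ i) ≡ π ⟨$⟩ʳ suc i
hat-of-non-LRMax π {i} {k} k<1+i larger =
  image-of-non-LRMax (π ⟨$⟩ʳ_) (⟨$⟩ʳ-injective π) (splitCycles-Split _ _) i
    λ (_ , max) → Fin.<-asym larger (max k k<1+i)

-- This is the tool for proving avoidance: an arrow into an entry that is not a left-to-right
-- maximum can only come from its left neighbour.
hat-cases : (π : Permutation′ (ℕ.suc m)) → ∀ {a j} → hat π a ≡ π ⟨$⟩ʳ j →
  (∀ i → i < j → π ⟨$⟩ʳ i < π ⟨$⟩ʳ j) ⊎ (∃[ i ] (j ≡ suc i × a ≡ π ⟨$⟩ʳ inject₁ i))
hat-cases π {a} {j} hat-a≡ =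
  cases (image (π ⟨$⟩ʳ zero) (π ⟨$⟩ʳ_) (⟨$⟩ʳ-injective π) (splitCycles-Split _ _) (π ⟨$⟩ˡ a))
    (trans (cong (hat π) (inverseʳ π)) hat-a≡) (inverseʳ π)
  where
  -- The image is a computed term, so it is generalized to a variable `y` before matching.
  cases : ∀ {k y} → Image (π ⟨$⟩ʳ zero) [] (π ⟨$⟩ʳ_) k y → y ≡ π ⟨$⟩ʳ j → π ⟨$⟩ʳ k ≡ a →
    (∀ i → i < j → π ⟨$⟩ʳ i < π ⟨$⟩ʳ j) ⊎ (∃[ i ] (j ≡ suc i × a ≡ π ⟨$⟩ʳ inject₁ i))
  cases toFirst y≡ _ with ⟨$⟩ʳ-injective π y≡
  ... | refl = inj₁ λ _ ()
  cases (toLRMax i (_ , max)) y≡ _ with ⟨$⟩ʳ-injective π y≡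
  ... | refl = inj₁ max
  cases (toNext i) y≡ πk≡a = inj₂ (i , sym (⟨$⟩ʳ-injective π y≡) , sym πk≡a)

-- Occurrences of the pattern

contains⁺ : (π : Permutation′ n) → ∀ {a i j} → i < j → a < π ⟨$⟩ʳ j → π ⟨$⟩ʳ j < π ⟨$⟩ʳ i →
  hat π a ≡ π ⟨$⟩ʳ j → Contains π pattern-32-1→2
contains⁺ {n} π {a} {i} {j} i<j a<πj πj<πi hat-a≡ =
  x , t , x-increasing , t-increasing , (λ { 0F → refl ; 1F → refl }) , hat-a≡ ∷ []
  where
  x : Fin 3 → Fin n
  -- The entries in the roles 1, 2, 3; the word 32 reads the last at `i` and the middle one at `j`.
  x = Vec.lookup (a Vec.∷ (π ⟨$⟩ʳ j) Vec.∷ (π ⟨$⟩ʳ i) Vec.∷ Vec.[])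
  t : Fin 2 → Fin n
  t = Vec.lookup (i Vec.∷ j Vec.∷ Vec.[])
  x-increasing : StrictlyIncreasing x
  x-increasing {0F} {1F} _ = a<πj
  x-increasing {0F} {2F} _ = Fin.<-trans {i = a} a<πj πj<πi
  x-increasing {1F} {2F} _ = πj<πi
  x-increasing {0F} {0F} ()
  x-increasing {1F} {0F} ()
  x-increasing {1F} {1F} (s≤s ())
  x-increasing {2F} {0F} ()
  x-increasing {2F} {1F} (s≤s ())
  x-increasing {2F} {2F} (s≤s (s≤s ()))
  t-increasing : StrictlyIncreasing t
  t-increasing {0F} {1F} _ = i<j
  t-increasing {0F} {0F} ()
  t-increasing {1F} {0F} ()
  t-increasing {1F} {1F} (s≤s ())

contains⁻ : (π : Permutation′ n) → Contains π pattern-32-1→2 →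
  ∃[ a ] ∃[ i ] ∃[ j ] (i < j × a < π ⟨$⟩ʳ j × π ⟨$⟩ʳ j < π ⟨$⟩ʳ i × hat π a ≡ π ⟨$⟩ʳ j)
contains⁻ π (x , t , x-increasing , t-increasing , word , hat≡ ∷ []) =
  x 0F , t 0F , t 1F , t-increasing z<s
  , subst (x 0F <_) (sym (word 1F)) (x-increasing z<s)
  , Fin.<-respˡ-≡ (sym (word 1F)) (subst (x 1F <_) (sym (word 0F)) (x-increasing (s<s z<s)))
  , trans hat≡ (sym (word 1F))

strictlyIncreasing⇒inflationary : {g : Fin n → Fin n} → StrictlyIncreasing g → ∀ i → i ≤ g i
strictlyIncreasing⇒inflationary {ℕ.suc n} {g} inc = <-weakInduction (λ i → i ≤ g i) z≤n
  λ i i≤gi → ℕ.≤-<-trans (subst (ℕ._≤ toℕ (g (inject₁ i))) (toℕ-inject₁ i) i≤gi)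
    (inc (inject₁<suc i))

-- A missed value could be punched out of the codomain, leaving an injection from a set of `suc n`
-- elements into one of `n`.
injective⇒surjective : {f : Fin n → Fin n} → Injective _≡_ _≡_ f → StrictlySurjective _≡_ f
injective⇒surjective {ℕ.suc n} {f} f-inj j with any? (λ i → f i ≟ j)
... | yes hit  = hit
... | no  miss = contradiction
  (Fin.injective⇒≤ {f = λ i → punchOut (λ eq → miss (i , sym eq))}
    (f-inj ∘ Fin.punchOut-injective {i = j} _ _))
  (ℕ.n≮n n)

-- The block order: u precedes v when the block of u has a smaller maximum,
-- or when u is the larger of two elements of one block.
Precedes : (Fin n → Fin n) → Rel (Fin n) 0ℓ
Precedes f u v = f u < f v ⊎ (f u ≡ f v × v < u)

precedes-trans : (f : Fin n → Fin n) → Transitive (Precedes f)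
precedes-trans f (inj₁ p)        (inj₁ q)        = inj₁ (ℕ.<-trans p q)
precedes-trans f {u} (inj₁ p)    (inj₂ (q , _))  = inj₁ (subst (f u <_) q p)
precedes-trans f {k = w} (inj₂ (p , _)) (inj₁ q) = inj₁ (subst (_< f w) (sym p) q)
precedes-trans f (inj₂ (p , p′)) (inj₂ (q , q′)) = inj₂ (trans p q , ℕ.<-trans q′ p′)

precedes-irrefl : (f : Fin n → Fin n) → ∀ {u} → ¬ Precedes f u u
precedes-irrefl f (inj₁ p)       = ℕ.<-irrefl refl p
precedes-irrefl f (inj₂ (_ , p)) = ℕ.<-irrefl refl p

precedes-asym : (f : Fin n → Fin n) → ∀ {u v} → Precedes f u v → ¬ Precedes f v u
precedes-asym f p q = precedes-irrefl f (precedes-trans f p q)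

precedes-compare : (f : Fin n → Fin n) → Trichotomous _≡_ (Precedes f)
precedes-compare f u v = compare (Fin.<-cmp (f u) (f v)) (Fin.<-cmp u v)
  where
  before : Precedes f u v → Tri (Precedes f u v) (u ≡ v) (Precedes f v u)
  before p = tri< p (λ { refl → precedes-irrefl f p }) (precedes-asym f p)
  after : Precedes f v u → Tri (Precedes f u v) (u ≡ v) (Precedes f v u)
  after p = tri> (precedes-asym f p) (λ { refl → precedes-irrefl f p }) p
  compare : Tri (f u < f v) (f u ≡ f v) (f v < f u) → Tri (u < v) (u ≡ v) (v < u) →
    Tri (Precedes f u v) (u ≡ v) (Precedes f v u)
  compare (tri< p _ _) _               = before (inj₁ p)
  compare (tri> _ _ p) _               = after (inj₁ p)
  compare (tri≈ _ p _) (tri> _ _ q)    = before (inj₂ (p , q))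
  compare (tri≈ _ p _) (tri< q _ _)    = after (inj₂ (sym p , q))
  compare (tri≈ _ _ _) (tri≈ _ refl _) = tri≈ (precedes-irrefl f) refl (precedes-irrefl f)

precedes-isStrictTotalOrder : (f : Fin n → Fin n) → IsStrictTotalOrder _≡_ (Precedes f)
precedes-isStrictTotalOrder f = isStrictTotalOrderᶜ record
  { isEquivalence = isEquivalence
  ; trans         = precedes-trans f
  ; compare       = precedes-compare f
  }

-- Sorting by a strict total order

module Sort {_≺_ : Rel (Fin n) 0ℓ} (isSTO : IsStrictTotalOrder _≡_ _≺_) where
  private
    module ≺ = IsStrictTotalOrder isSTO

  below : Fin n → Subset n
  below v = ⟦ (λ u → u ≺.<? v) ⟧

  below-mono : ∀ {u v} → u ≺ v → below u ⊂ below v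
  below-mono {u} {v} u≺v =
      (λ w∈ → ∈⟦⟧⁺ (≺._<? v) (≺.trans (∈⟦⟧⁻ (≺._<? u) w∈) u≺v))
    , u , ∈⟦⟧⁺ (≺._<? v) u≺v , λ u∈ → ≺.irrefl refl (∈⟦⟧⁻ (≺._<? u) u∈)

  ∣below∣<n : ∀ v → ∣ below v ∣ ℕ.< n
  ∣below∣<n v = subst (∣ below v ∣ ℕ.<_) (∣⊤∣≡n n)
    (p⊂q⇒∣p∣<∣q∣ ((λ _ → ∈⊤) , v , ∈⊤ , λ v∈ → ≺.irrefl refl (∈⟦⟧⁻ (≺._<? v) v∈)))

  rank : Fin n → Fin n
  rank v = fromℕ< (∣below∣<n v)

  rank-mono : ∀ {u v} → u ≺ v → rank u < rank v
  rank-mono {u} {v} u≺v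
    rewrite Fin.toℕ-fromℕ< (∣below∣<n u) | Fin.toℕ-fromℕ< (∣below∣<n v) =
    p⊂q⇒∣p∣<∣q∣ (below-mono u≺v)

  rank-injective : Injective _≡_ _≡_ rank
  rank-injective {u} {v} eq with ≺.compare u v
  ... | tri< u≺v _ _ = contradiction eq (Fin.<⇒≢ (rank-mono u≺v))
  ... | tri≈ _ u≡v _ = u≡v
  ... | tri> _ _ v≺u = contradiction (sym eq) (Fin.<⇒≢ (rank-mono v≺u))

  -- Position `i` holds the element of rank `i`. The inverse of `sort` is thus `rank` by definition,
  -- and `rank-mono` says that the word is sorted.
  sort : Permutation′ n
  sort = permutation (λ i → proj₁ (rank-surjective i)) rank
    (λ v → rank-injective (proj₂ (rank-surjective (rank v))))
    (λ i → proj₂ (rank-surjective i))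
    where
    rank-surjective : StrictlySurjective _≡_ rank
    rank-surjective = injective⇒surjective rank-injective

-- Prefix maxima and the structure of avoiders

module PrefixMax {n} (π : Permutation′ n) =
  GreatestBelow (λ u v → π ⟨$⟩ˡ u ≤ π ⟨$⟩ˡ v) (λ u v → π ⟨$⟩ˡ u ≤? π ⟨$⟩ˡ v) ℕ.≤-refl ℕ.≤-trans

-- The argument is an entry rather than a position, so that the result is comparable with the block
-- maximum of a partition.
prefixMax : Permutation′ n → Fin n → Fin n
prefixMax = PrefixMax.closure

⟨$⟩ˡ-cong : (π π′ : Permutation′ n) → (π ⟨$⟩ʳ_) ≗ (π′ ⟨$⟩ʳ_) → (π ⟨$⟩ˡ_) ≗ (π′ ⟨$⟩ˡ_)
⟨$⟩ˡ-cong π π′ eq v = ⟨$⟩ʳ-injective π′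
  (trans (sym (eq (π ⟨$⟩ˡ v))) (trans (inverseʳ π) (sym (inverseʳ π′))))

prefixMax-cong : (π π′ : Permutation′ n) → (π ⟨$⟩ʳ_) ≗ (π′ ⟨$⟩ʳ_) → prefixMax π ≗ prefixMax π′
prefixMax-cong {n} π π′ eq v = PrefixMax.closure-unique π
  ( transport (sym ∘ ⟨$⟩ˡ-cong π π′ eq) (PrefixMax.closure-below π′ v)
  , λ k k≤v → PrefixMax.closure-greatest π′ (transport (⟨$⟩ˡ-cong π π′ eq) k≤v))
  where
  transport : ∀ {p q : Fin n → Fin n} {u v} → p ≗ q → p u ≤ p v → q u ≤ q v
  transport {u = u} {v} p≗q pu≤pv rewrite sym (p≗q u) | sym (p≗q v) = pu≤pv

prefixMax-mono : (π : Permutation′ n) → ∀ {i j} → i ≤ j →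
  prefixMax π (π ⟨$⟩ʳ i) ≤ prefixMax π (π ⟨$⟩ʳ j)
prefixMax-mono π i≤j = PrefixMax.closure-mono π
  (subst₂ _≤_ (sym (inverseˡ π)) (sym (inverseˡ π)) i≤j)

-- Induction on the later position: a stretch with constant prefix maximum contains no ascent,
-- because an ascent would complete an occurrence with that maximum in the role of 3.
avoider-descends : (π : Permutation′ n) → Avoids π pattern-32-1→2 → ∀ j {i} → i < j →
  prefixMax π (π ⟨$⟩ʳ i) ≡ prefixMax π (π ⟨$⟩ʳ j) → π ⟨$⟩ʳ j < π ⟨$⟩ʳ i
avoider-descends {ℕ.suc n} π avoids = <-weakInduction
  (λ j → ∀ {i} → i < j → prefixMax π (π ⟨$⟩ʳ i) ≡ prefixMax π (π ⟨$⟩ʳ j) → π ⟨$⟩ʳ j < π ⟨$⟩ʳ i)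
  (λ ()) descend
  where
  descend : ∀ j →
    (∀ {i} → i < inject₁ j → prefixMax π (π ⟨$⟩ʳ i) ≡ prefixMax π (π ⟨$⟩ʳ inject₁ j) →
      π ⟨$⟩ʳ inject₁ j < π ⟨$⟩ʳ i) →
    ∀ {i} → i < suc j → prefixMax π (π ⟨$⟩ʳ i) ≡ prefixMax π (π ⟨$⟩ʳ suc j) →
      π ⟨$⟩ʳ suc j < π ⟨$⟩ʳ i
  descend j ih {i} i<1+j eq = continue (i ≟ inject₁ j)
    where
    -- The shared maximum `M` stands at a position `k` no later than `i`, hence before `suc j`, and
    -- exceeds the entry at `suc j`.
    M = prefixMax π (π ⟨$⟩ʳ i)
    k = π ⟨$⟩ˡ M

    k<1+j : k < suc j
    k<1+j = ℕ.≤-<-trans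
      (subst (k ≤_) (inverseˡ π) (PrefixMax.closure-below π (π ⟨$⟩ʳ i))) i<1+j

    larger : π ⟨$⟩ʳ suc j < π ⟨$⟩ʳ k
    larger = Fin.≤∧≢⇒<
      (subst (π ⟨$⟩ʳ suc j ≤_) (trans (sym eq) (sym (inverseʳ π)))
        (PrefixMax.closure-greatest π ℕ.≤-refl))
      (λ same → Fin.<⇒≢ k<1+j (sym (⟨$⟩ʳ-injective π same)))

    descent : π ⟨$⟩ʳ suc j < π ⟨$⟩ʳ inject₁ j
    descent with Fin.<-cmp (π ⟨$⟩ʳ suc j) (π ⟨$⟩ʳ inject₁ j)
    ... | tri< lt _ _ = lt
    ... | tri≈ _ same _ =
      contradiction (sym (⟨$⟩ʳ-injective π same)) (Fin.<⇒≢ (inject₁<suc j))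
    -- The entry at `suc j` is not a left-to-right maximum, so `hat π` sends its left neighbour to
    -- it; together with `M` they form the pattern.
    ... | tri> _ _ gt = contradiction
      (contains⁺ π k<1+j gt larger (hat-of-non-LRMax π k<1+j larger)) avoids

    i≤j : i ≤ inject₁ j
    i≤j = <suc⇒≤inject₁ i<1+j

    continue : Dec (i ≡ inject₁ j) → π ⟨$⟩ʳ suc j < π ⟨$⟩ʳ i
    continue (yes refl) = descent
    -- The prefix maximum at `inject₁ j` is squeezed between the equal ones at `i` and `suc j`.
    continue (no i≢j)   = ℕ.<-trans descent (ih (Fin.≤∧≢⇒< i≤j i≢j)
      (Fin.≤-antisym (prefixMax-mono π i≤j)
        (subst (prefixMax π (π ⟨$⟩ʳ inject₁ j) ≤_) (sym eq)
          (prefixMax-mono π (ℕ.<⇒≤ (inject₁<suc j))))))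

-- Prefix maxima never decrease along the word, and entries sharing one descend. Thus `prefixMax π`
-- alone dictates the order of the entries.
avoider-ordered : (π : Permutation′ n) → Avoids π pattern-32-1→2 → ∀ {i j} → i < j →
  Precedes (prefixMax π) (π ⟨$⟩ʳ i) (π ⟨$⟩ʳ j)
avoider-ordered π avoids {i} {j} i<j
  with prefixMax π (π ⟨$⟩ʳ i) ≟ prefixMax π (π ⟨$⟩ʳ j)
... | yes same  = inj₂ (same , avoider-descends π avoids j i<j same)
... | no  other = inj₁ (Fin.≤∧≢⇒< (prefixMax-mono π (ℕ.<⇒≤ i<j)) other)

module _ (π π′ : Permutation′ n)
  (avoids : Avoids π pattern-32-1→2) (avoids′ : Avoids π′ pattern-32-1→2)
  (eq : prefixMax π ≗ prefixMax π′) where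

  -- Both words list the entries in the block order of the common prefix maximum, so an inversion
  -- between them would contradict asymmetry.
  avoiders-relabelling-increasing : StrictlyIncreasing (λ i → π′ ⟨$⟩ˡ (π ⟨$⟩ʳ i))
  avoiders-relabelling-increasing {i} {j} i<j
    with Fin.<-cmp (π′ ⟨$⟩ˡ (π ⟨$⟩ʳ i)) (π′ ⟨$⟩ˡ (π ⟨$⟩ʳ j))
  ... | tri< lt _ _ = lt
  ... | tri≈ _ same _ =
    contradiction (⟨$⟩ʳ-injective π (⟨$⟩ˡ-injective π′ same)) (Fin.<⇒≢ i<j)
  ... | tri> _ _ gt = contradiction
    (avoider-ordered π avoids i<j)
    (precedes-asym (prefixMax π) (backwards (avoider-ordered π′ avoids′ gt)))
    where
    backwards :
      Precedes (prefixMax π′) (π′ ⟨$⟩ʳ (π′ ⟨$⟩ˡ (π ⟨$⟩ʳ j))) (π′ ⟨$⟩ʳ (π′ ⟨$⟩ˡ (π ⟨$⟩ʳ i))) →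
      Precedes (prefixMax π) (π ⟨$⟩ʳ j) (π ⟨$⟩ʳ i)
    backwards p rewrite inverseʳ π′ {π ⟨$⟩ʳ i} | inverseʳ π′ {π ⟨$⟩ʳ j}
      | eq (π ⟨$⟩ʳ i) | eq (π ⟨$⟩ʳ j) = p

-- The relabelling `g` and its inverse are both strictly increasing, hence both inflationary, which
-- forces `g` to be the identity.
prefixMax-injective : (π π′ : Permutation′ n) →
  Avoids π pattern-32-1→2 → Avoids π′ pattern-32-1→2 →
  prefixMax π ≗ prefixMax π′ → (π ⟨$⟩ʳ_) ≗ (π′ ⟨$⟩ʳ_)
prefixMax-injective π π′ avoids avoids′ eq i =
  trans (sym (inverseʳ π′)) (cong (π′ ⟨$⟩ʳ_) (Fin.≤-antisym
    (subst (g i ≤_) (trans (cong (π ⟨$⟩ˡ_) (inverseʳ π′)) (inverseˡ π))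
      (strictlyIncreasing⇒inflationary
        (avoiders-relabelling-increasing π′ π avoids′ avoids (sym ∘ eq)) (g i)))
    (strictlyIncreasing⇒inflationary
      (avoiders-relabelling-increasing π π′ avoids avoids′ eq) i)))
  where
  g : Fin _ → Fin _
  g i = π′ ⟨$⟩ˡ (π ⟨$⟩ʳ i)

-- Words sorted by the block order

module Sorted {f : Fin n → Fin n} (isC : IsClosure f) (π : Permutation′ n)
  (sorted : ∀ {u v} → Precedes f u v → π ⟨$⟩ˡ u < π ⟨$⟩ˡ v) where
  open IsClosure isC

  sorted-reflects : ∀ {u v} → π ⟨$⟩ˡ u < π ⟨$⟩ˡ v → Precedes f u v
  sorted-reflects {u} {v} lt with precedes-compare f u v
  ... | tri< u≺v _ _  = u≺v
  ... | tri≈ _ refl _ = contradiction lt (ℕ.<-irrefl refl)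
  ... | tri> _ _ v≺u  = contradiction lt (ℕ.<-asym (sorted v≺u))

  position-≤⇒f-≤ : ∀ {u v} → π ⟨$⟩ˡ u ≤ π ⟨$⟩ˡ v → f u ≤ f v
  position-≤⇒f-≤ u≤v = ℕ.≮⇒≥ λ fv<fu → ℕ.≤⇒≯ u≤v (sorted (inj₁ fv<fu))

  max-first : ∀ v → v ≡ f v ⊎ π ⟨$⟩ˡ f v < π ⟨$⟩ˡ v
  max-first v with v ≟ f v
  ... | yes v≡fv = inj₁ v≡fv
  ... | no  v≢fv = inj₂ (sorted (inj₂ (idempotent v , Fin.≤∧≢⇒< (inflationary v) v≢fv)))

  -- Blocks are written in decreasing order, so `f v` stands no later than `v`; any `k` up to there
  -- satisfies `k ≤ f k ≤ f v`.
  prefixMax-sorted : prefixMax π ≗ f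
  prefixMax-sorted v = PrefixMax.closure-unique π
    ( Sum.[ (λ v≡fv → ℕ.≤-reflexive (cong (λ w → toℕ (π ⟨$⟩ˡ w)) (sym v≡fv))) , ℕ.<⇒≤ ]
        (max-first v)
    , λ k k≤v → ℕ.≤-trans (inflationary k) (position-≤⇒f-≤ k≤v))

-- In an occurrence the 2 has a larger entry before it, so its left neighbour is the 1. This ascent
-- makes the 2 start a block, whose maximum it then is, but the earlier 3 belongs to a block with a
-- smaller maximum.
sorted⇒avoids : {f : Fin n → Fin n} → IsClosure f → (π : Permutation′ n) →
  (∀ {u v} → Precedes f u v → π ⟨$⟩ˡ u < π ⟨$⟩ˡ v) → Avoids π pattern-32-1→2
sorted⇒avoids {ℕ.zero} _ π _ contains = contradiction (proj₁ contains 0F) λ ()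
sorted⇒avoids {ℕ.suc n} {f} isC π sorted contains
  with a , i , j , i<j , a<b , b<c , hat-a≡b ← contains⁻ π contains
  with hat-cases π hat-a≡b
... | inj₁ max = ℕ.<-asym b<c (max i i<j)
... | inj₂ (i′ , refl , refl) = Sum.[ b-max , b-not-max ] (max-first b)
  where
  open IsClosure isC
  open Sorted isC π sorted
  b = π ⟨$⟩ʳ suc i′
  c = π ⟨$⟩ʳ i

  -- Within a block the word descends, so the ascent from `a` to `b` crosses into a block with
  -- larger maximum.
  fa<fb : f a < f b
  fa<fb with sorted-reflects {a} {b}
    (subst₂ _<_ (sym (inverseˡ π)) (sym (inverseˡ π)) (inject₁<suc i′))
  ... | inj₁ lt        = lt
  ... | inj₂ (_ , b<a) = contradiction a<b (ℕ.<-asym b<a)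

  -- `a` is the last entry before `b`, and `f` is weakly increasing along the word.
  before-b : ∀ {v} → π ⟨$⟩ˡ v < suc i′ → f v ≤ f a
  before-b {v} v<b = position-≤⇒f-≤
    (subst (π ⟨$⟩ˡ v ≤_) (sym (inverseˡ π)) (<suc⇒≤inject₁ v<b))

  b-max : b ≢ f b
  b-max b≡fb = ℕ.<-irrefl refl (begin-strict
    toℕ b     <⟨ b<c ⟩
    toℕ c     ≤⟨ inflationary c ⟩
    toℕ (f c) ≤⟨ before-b (subst (_< suc i′) (sym (inverseˡ π)) i<j) ⟩
    toℕ (f a) <⟨ fa<fb ⟩
    toℕ (f b) ≡⟨ cong toℕ b≡fb ⟨
    toℕ b     ∎)
    where open ℕ.≤-Reasoning

  -- An `f b` standing before `b` would give `f (f b) ≤ f a`, that is `f b ≤ f a`.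
  b-not-max : ¬ (π ⟨$⟩ˡ f b < π ⟨$⟩ˡ b)
  b-not-max lt = ℕ.<⇒≱ fa<fb
    (subst (_≤ f a) (idempotent b) (before-b (subst (π ⟨$⟩ˡ f b <_) (inverseˡ π) lt)))

module BlockWord {f : Fin n → Fin n} (isC : IsClosure f) where
  open Sort (precedes-isStrictTotalOrder f)

  blockWord : Permutation′ n
  blockWord = sort

  avoids-blockWord : Avoids blockWord pattern-32-1→2
  avoids-blockWord = sorted⇒avoids isC blockWord rank-mono

  prefixMax-blockWord : prefixMax blockWord ≗ f
  prefixMax-blockWord = Sorted.prefixMax-sorted isC blockWord rank-mono

-- The bijection for avoiders and the count

avoiders⤖closures : ∀ n → Bijection (Avoiders n pattern-32-1→2) (Closures n)
avoiders⤖closures n = mkBijection (Avoiders n pattern-32-1→2) (Closures n)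
  (λ (π , _) → prefixMax π , PrefixMax.isClosure π)
  (λ {x} {y} → prefixMax-cong (proj₁ x) (proj₁ y))
  (λ {x} {y} → prefixMax-injective (proj₁ x) (proj₁ y) (proj₂ x) (proj₂ y))
  (λ (f , isC) → (BlockWord.blockWord isC , BlockWord.avoids-blockWord isC)
                , BlockWord.prefixMax-blockWord isC)

theorem6p1 : ∀ (n : ℕ) → 1 ℕ.≤ n →
    ∃[ b ] (IsBellNumber n b × (Avoiders n pattern-32-1→2) HasCardinality b)
theorem6p1 n _ =
  -- The common number `b` counts the closure functions; each side reaches it through its own
  -- bijection with them.
  let b , closures = closures-finite n
  in b , Composition.bijection (partitions⤖closures n) closures
       , Composition.bijection (avoiders⤖closures n) closures
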